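{- Let $G$ be a finite simple undirected graph and let $S$ be a spectrum (finite set of colors) endowed with a symmetric matrix $W$ of non-negative real interferences, of size $|S|\times|S|$. For every natural number $k$ with $2\le k\le |S|$, the minimum $k$-chromatic threshold $T_k(G,W)$ satisfies $$T_k(G,W)\le \frac{\Delta(G)\,\|W\|_\infty}{k},$$ where $\Delta(G)$ is the maximum vertex degree of $G$. Furthermore, this bound is tight, i.e., there exist a finite simple undirected graph $G$, a spectrum $S$ endowed with a symmetric $|S|\times|S|$ matrix $W$ of non-negative real interferences, and a natural number $k$ with $2\le k\le |S|$, for which $T_k(G,W)=\frac{\Delta(G)\,\|W\|_\infty}{k}$.
   Context: A spectrum is a finite set of colors $S=\{c_1,\ldots,c_s\}$, $s=|S|$, endowed with a symmetric $s\times s$ matrix $W$ of non-negative reals; $W(c_i,c_j)=W_{ij}$ is the interference between colors $c_i$ and $c_j$. A coloring of $G=(V,E)$ is any map $c:V\to S$ (monochromatic edges are allowed). A $k$-coloring is a coloring using at most $k$ different colors of $S$. The interference induced by $c$ at a vertex $v$ is $I_v(G,W,c)=\sum_{u\in N(v)}W(c(u),c(v))$, where $N(v)$ is the set of neighbors of $v$. The minimum $k$-chromatic threshold $T_k(G,W)$ is the minimum $t\in\mathbb{R}_{\ge 0}$ such that $(G,W)$ admits a $k$-coloring $c$ with $I_v(G,W,c)\le t$ for every vertex $v$. The norm is $\|W\|_\infty=\max_i\sum_j W_{ij}$, taken over the whole matrix $W$. -}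

module Defs where

open import Data.Nat.Base as ℕ using (ℕ)
open import Data.Nat.Properties as ℕ using ()
open import Data.Rational.Base as ℚ using (ℚ; 0ℚ; 1ℚ; ½)
open import Data.Rational.Properties as ℚ using ()
open import Data.Rational.Solver using (module +-*-Solver)
open import Data.Fin.Base using (Fin)
open import Data.Fin.Subset using (Subset; ⁅_⁆; ⋃; ∣_∣)
open import Data.List.Base using (List; foldr; tabulate; map; filter; length; allFin)
open import Data.List.Extrema.Nat using (max)
open import Data.Product.Base using (∃-syntax; _×_; _,_)
open import Data.Sum.Base using (inj₁; inj₂)
open import Level using (0ℓ)
open import Relation.Binary.Core using (Rel)
open import Relation.Binary.Definitions using (Symmetric; Irreflexive; Decidable)
open import Relation.Binary.PropositionalEquality using (_≡_; refl; sym; trans; cong; subst)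
open import Relation.Nullary.Negation using (¬_)

-- Real numbers, as rational Cauchy sequences.  Equality of reals is _≈_.
record ℝ : Set where
  constructor mkℝ
  field
    seq    : ℕ → ℚ
    cauchy : ∀ ε → 0ℚ ℚ.< ε →
             ∃[ N ] (∀ m n → N ℕ.≤ m → N ℕ.≤ n → ℚ.∣ seq m ℚ.- seq n ∣ ℚ.≤ ε)

open ℝ public

infix 4 _≤_ _≈_

-- The inequality seq x n ≤ seq y n may fail for every n when the limits
-- agree, hence the slack ε.
_≤_ : Rel ℝ 0ℓ
x ≤ y = ∀ ε → 0ℚ ℚ.< ε → ∃[ N ] (∀ n → N ℕ.≤ n → seq x n ℚ.≤ seq y n ℚ.+ ε)

_≈_ : Rel ℝ 0ℓ
x ≈ y = x ≤ y × y ≤ x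

½ε>0 : ∀ {ε} → 0ℚ ℚ.< ε → 0ℚ ℚ.< ½ ℚ.* ε
½ε>0 {ε} ε>0 = subst (ℚ._< ½ ℚ.* ε) (ℚ.*-zeroʳ ½) (ℚ.*-monoʳ-<-pos ½ ε>0)

½ε+½ε≡ε : ∀ ε → ½ ℚ.* ε ℚ.+ ½ ℚ.* ε ≡ ε
½ε+½ε≡ε ε = trans (sym (ℚ.*-distribʳ-+ ε ½ ½)) (ℚ.*-identityˡ ε)

∣p-q∣≤ε⇒p≤q+ε : ∀ p q {ε} → ℚ.∣ p ℚ.- q ∣ ℚ.≤ ε → p ℚ.≤ q ℚ.+ ε
∣p-q∣≤ε⇒p≤q+ε p q {ε} h = begin
  p                         ≡⟨ solve 2 (λ p q → p := q :+ (p :- q)) refl p q ⟩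
  q ℚ.+ (p ℚ.- q)           ≤⟨ ℚ.+-monoʳ-≤ q (p≤∣p∣ (p ℚ.- q)) ⟩
  q ℚ.+ ℚ.∣ p ℚ.- q ∣       ≤⟨ ℚ.+-monoʳ-≤ q h ⟩
  q ℚ.+ ε                   ∎
  where
  open ℚ.≤-Reasoning
  open +-*-Solver
  p≤∣p∣ : ∀ p → p ℚ.≤ ℚ.∣ p ∣
  p≤∣p∣ p with ℚ.≤-total 0ℚ p
  ... | inj₁ 0≤p = ℚ.≤-reflexive (sym (ℚ.0≤p⇒∣p∣≡p 0≤p))
  ... | inj₂ p≤0 = ℚ.≤-trans p≤0 (ℚ.0≤∣p∣ p)

p≤q+ε⇒p-q≤ε : ∀ p q {ε} → p ℚ.≤ q ℚ.+ ε → p ℚ.- q ℚ.≤ ε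
p≤q+ε⇒p-q≤ε p q {ε} h = begin
  p ℚ.- q             ≤⟨ ℚ.+-monoˡ-≤ (ℚ.- q) h ⟩
  (q ℚ.+ ε) ℚ.- q     ≡⟨ solve 2 (λ q ε → (q :+ ε) :- q := ε) refl q ε ⟩
  ε                   ∎
  where
  open ℚ.≤-Reasoning
  open +-*-Solver

p≤q+ε⇒∣p-q∣≤ε : ∀ p q {ε} → p ℚ.≤ q ℚ.+ ε → q ℚ.≤ p ℚ.+ ε → ℚ.∣ p ℚ.- q ∣ ℚ.≤ ε
p≤q+ε⇒∣p-q∣≤ε p q {ε} h₁ h₂ with ℚ.∣p∣≡p∨∣p∣≡-p (p ℚ.- q)
... | inj₁ e = subst (ℚ._≤ ε) (sym e) (p≤q+ε⇒p-q≤ε p q h₁)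
... | inj₂ e = subst (ℚ._≤ ε) (trans (solve 2 (λ p q → q :- p := :- (p :- q)) refl p q) (sym e))
                     (p≤q+ε⇒p-q≤ε q p h₂)
  where open +-*-Solver

0ℝ : ℝ
0ℝ = mkℝ (λ _ → 0ℚ) λ _ ε>0 → 0 , λ _ _ _ _ → ℚ.<⇒≤ ε>0

infixl 6 _+_ _⊔_
infixr 7 _·_

_+_ : ℝ → ℝ → ℝ
seq (x + y) n = seq x n ℚ.+ seq y n
cauchy (x + y) ε ε>0 with cauchy x (½ ℚ.* ε) (½ε>0 ε>0) | cauchy y (½ ℚ.* ε) (½ε>0 ε>0)
... | M , hx | N , hy = M ℕ.⊔ N , λ m n ≤m ≤n → begin
  ℚ.∣ (seq x m ℚ.+ seq y m) ℚ.- (seq x n ℚ.+ seq y n) ∣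
    ≡⟨ cong ℚ.∣_∣ (solve 4 (λ a b c d → (a :+ b) :- (c :+ d) := (a :- c) :+ (b :- d))
                     refl (seq x m) (seq y m) (seq x n) (seq y n)) ⟩
  ℚ.∣ (seq x m ℚ.- seq x n) ℚ.+ (seq y m ℚ.- seq y n) ∣
    ≤⟨ ℚ.∣p+q∣≤∣p∣+∣q∣ (seq x m ℚ.- seq x n) (seq y m ℚ.- seq y n) ⟩
  ℚ.∣ seq x m ℚ.- seq x n ∣ ℚ.+ ℚ.∣ seq y m ℚ.- seq y n ∣
    ≤⟨ ℚ.+-mono-≤ (hx m n (ℕ.m⊔n≤o⇒m≤o M N ≤m) (ℕ.m⊔n≤o⇒m≤o M N ≤n))
                  (hy m n (ℕ.m⊔n≤o⇒n≤o M N ≤m) (ℕ.m⊔n≤o⇒n≤o M N ≤n)) ⟩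
  ½ ℚ.* ε ℚ.+ ½ ℚ.* ε
    ≡⟨ ½ε+½ε≡ε ε ⟩
  ε ∎
  where
  open ℚ.≤-Reasoning
  open +-*-Solver

_⊔_ : ℝ → ℝ → ℝ
seq (x ⊔ y) n = seq x n ℚ.⊔ seq y n
cauchy (x ⊔ y) ε ε>0 with cauchy x ε ε>0 | cauchy y ε ε>0
... | M , hx | N , hy = M ℕ.⊔ N , λ m n ≤m ≤n →
  p≤q+ε⇒∣p-q∣≤ε _ _ (bound m n ≤m ≤n) (bound n m ≤n ≤m)
  where
  bound : ∀ m n → M ℕ.⊔ N ℕ.≤ m → M ℕ.⊔ N ℕ.≤ n →
          seq x m ℚ.⊔ seq y m ℚ.≤ (seq x n ℚ.⊔ seq y n) ℚ.+ ε
  bound m n ≤m ≤n = ℚ.⊔-lub {_} {seq x m} {seq y m}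
    (ℚ.≤-trans
      (∣p-q∣≤ε⇒p≤q+ε (seq x m) (seq x n) (hx m n (ℕ.m⊔n≤o⇒m≤o M N ≤m) (ℕ.m⊔n≤o⇒m≤o M N ≤n)))
      (ℚ.+-monoˡ-≤ ε (ℚ.p≤p⊔q (seq x n) (seq y n))))
    (ℚ.≤-trans
      (∣p-q∣≤ε⇒p≤q+ε (seq y m) (seq y n) (hy m n (ℕ.m⊔n≤o⇒n≤o M N ≤m) (ℕ.m⊔n≤o⇒n≤o M N ≤n)))
      (ℚ.+-monoˡ-≤ ε (ℚ.p≤q⊔p (seq x n) (seq y n))))

∃δ>0-∣q∣δ≤ε : ∀ q ε → 0ℚ ℚ.< ε → ∃[ δ ] (0ℚ ℚ.< δ × ℚ.∣ q ∣ ℚ.* δ ℚ.≤ ε)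
∃δ>0-∣q∣δ≤ε q ε ε>0 = δ , δ>0 , (begin
  ℚ.∣ q ∣ ℚ.* δ          ≤⟨ ℚ.*-monoʳ-≤-nonNeg δ ∣q∣≤r ⟩
  r ℚ.* δ                ≡⟨ ℚ.*-assoc r (ℚ.1/ r) ε ⟨
  r ℚ.* ℚ.1/ r ℚ.* ε     ≡⟨ cong (ℚ._* ε) (ℚ.*-inverseʳ r) ⟩
  1ℚ ℚ.* ε               ≡⟨ ℚ.*-identityˡ ε ⟩
  ε                      ∎)
  where
  open ℚ.≤-Reasoning
  r : ℚ
  r = ℚ.∣ q ∣ ℚ.+ 1ℚ
  ∣q∣≤r : ℚ.∣ q ∣ ℚ.≤ r
  ∣q∣≤r = subst (ℚ._≤ r) (ℚ.+-identityʳ ℚ.∣ q ∣)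
            (ℚ.+-monoʳ-≤ ℚ.∣ q ∣ (ℚ.<⇒≤ (ℚ.positive⁻¹ 1ℚ)))
  instance
    r-pos : ℚ.Positive r
    r-pos = ℚ.positive (ℚ.+-mono-≤-< (ℚ.0≤∣p∣ q) (ℚ.positive⁻¹ 1ℚ))
    r-nonZero : ℚ.NonZero r
    r-nonZero = ℚ.pos⇒nonZero r
    1/r-pos : ℚ.Positive (ℚ.1/ r)
    1/r-pos = ℚ.1/pos⇒pos r
  δ : ℚ
  δ = ℚ.1/ r ℚ.* ε
  δ>0 : 0ℚ ℚ.< δ
  δ>0 = subst (ℚ._< δ) (ℚ.*-zeroʳ (ℚ.1/ r)) (ℚ.*-monoʳ-<-pos (ℚ.1/ r) ε>0)
  instance
    δ-nonNeg : ℚ.NonNegative δ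
    δ-nonNeg = ℚ.nonNegative (ℚ.<⇒≤ δ>0)

_·_ : ℚ → ℝ → ℝ
seq (q · x) n = q ℚ.* seq x n
cauchy (q · x) ε ε>0 with ∃δ>0-∣q∣δ≤ε q ε ε>0
... | δ , δ>0 , ∣q∣δ≤ε with cauchy x δ δ>0
... | N , h = N , λ m n ≤m ≤n → begin
  ℚ.∣ q ℚ.* seq x m ℚ.- q ℚ.* seq x n ∣
    ≡⟨ cong ℚ.∣_∣ (solve 3 (λ q a b → q :* a :- q :* b := q :* (a :- b))
                     refl q (seq x m) (seq x n)) ⟩
  ℚ.∣ q ℚ.* (seq x m ℚ.- seq x n) ∣
    ≡⟨ ℚ.∣p*q∣≡∣p∣*∣q∣ q (seq x m ℚ.- seq x n) ⟩
  ℚ.∣ q ∣ ℚ.* ℚ.∣ seq x m ℚ.- seq x n ∣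
    ≤⟨ ℚ.*-monoˡ-≤-nonNeg ℚ.∣ q ∣ {{ℚ.nonNegative (ℚ.0≤∣p∣ q)}} (h m n ≤m ≤n) ⟩
  ℚ.∣ q ∣ ℚ.* δ
    ≤⟨ ∣q∣δ≤ε ⟩
  ε ∎
  where
  open ℚ.≤-Reasoning
  open +-*-Solver

sumℝ : List ℝ → ℝ
sumℝ = foldr _+_ 0ℝ

-- Only applied to lists of non-negative reals, for which starting from 0 does
-- not change the maximum of a non-empty list.
maxℝ : List ℝ → ℝ
maxℝ = foldr _⊔_ 0ℝ

record Graph (n : ℕ) : Set₁ where
  infix 4 _~_ _~?_
  field
    _~_      : Rel (Fin n) 0ℓ
    _~?_     : Decidable _~_
    ~-sym    : Symmetric _~_
    ~-irrefl : Irreflexive _≡_ _~_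

  neighbours : Fin n → List (Fin n)
  neighbours v = filter (v ~?_) (allFin n)

  degree : Fin n → ℕ
  degree v = length (neighbours v)

Δ : ∀ {n} → Graph n → ℕ
Δ G = max 0 (tabulate degree)
  where open Graph G

record Spectrum (s : ℕ) : Set where
  field
    W        : Fin s → Fin s → ℝ
    W-sym    : ∀ i j → W i j ≈ W j i
    W-nonneg : ∀ i j → 0ℝ ≤ W i j

‖_‖∞ : ∀ {s} → Spectrum s → ℝ
‖ S ‖∞ = maxℝ (tabulate λ i → sumℝ (tabulate λ j → W i j))
  where open Spectrum S

Colouring : ℕ → ℕ → Set
Colouring n s = Fin n → Fin s

coloursUsed : ∀ {n s} → Colouring n s → Subset s
coloursUsed c = ⋃ (tabulate λ v → ⁅ c v ⁆)

IsColouringWith : ∀ {n s} → ℕ → Colouring n s → Set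
IsColouringWith k c = ∣ coloursUsed c ∣ ℕ.≤ k

interference : ∀ {n s} → Graph n → Spectrum s → Colouring n s → Fin n → ℝ
interference G S c v = sumℝ (map (λ u → W (c u) (c v)) (neighbours v))
  where open Graph G; open Spectrum S

Admits : ∀ {n s} → Graph n → Spectrum s → ℕ → ℝ → Set
Admits G S k t =
  ∃[ c ] (IsColouringWith k c × (∀ v → interference G S c v ≤ t))

-- t is the minimum of the set of admissible thresholds in ℝ≥0.  Membership of t
-- is double-negated: classically this changes nothing, while constructively
-- a colouring attaining the minimum cannot be selected, because the order on ℝ
-- is undecidable.
IsMinThreshold : ∀ {n s} → Graph n → Spectrum s → ℕ → ℝ → Set
IsMinThreshold G S k t =
  0ℝ ≤ t × ¬ ¬ Admits G S k t × (∀ t′ → 0ℝ ≤ t′ → Admits G S k t′ → t ≤ t′)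

{-# OPTIONS --safe #-}
module Submission where

-- Fix k of the colours and take a colouring c by them that minimises the
-- potential Φ = ∑ᵥ Iᵥ.  Recolouring a single vertex v changes Φ by twice the
-- change of the interference at v, so Iᵥ(c) is at most the interference that v
-- would receive in any of the k colours.  Summing over these colours,
-- k · Iᵥ(c) ≤ ∑_{u ∈ N(v)} ∑ⱼ W(c(u), j) ≤ Δ(G) · ‖W‖∞.
-- A minimising colouring exists only up to double negation, which suffices
-- because ≤ on ℝ is ¬¬-stable.
-- For tightness: on K₂ with an all-ones 2 × 2 matrix every colouring induces
-- interference 1 = 1 · 2 / 2.

open import Algebra.Bundles using (CommutativeMonoid)
open import Algebra.Core using (Op₂)
open import Algebra.Structures using (IsCommutativeMonoid)
open import Data.Bool.Base using (if_then_else_; true; false)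
open import Data.Fin.Base using (Fin; zero; suc; inject≤; punchIn; finToFun; funToFin)
import Data.Fin.Properties as Fin
open import Data.Fin.Subset using (Subset; ⁅_⁆; ⋃; ∣_∣; _∪_; _⊆_; inside; outside)
open import Data.Fin.Subset.Properties
  using (p⊆p∪q; q⊆p∪q; x∈p∪q⁻; ∣⊥∣≡0; ∣⁅x⁆∣≡1; p⊆q⇒∣p∣≤∣q∣; ⊆-trans; ⊆-min)
open import Data.Integer.Base using (+_)
import Data.Integer.Properties as ℤ
import Data.Integer.Solver as ℤ
open import Data.List.Base
  using (List; []; _∷_; map; filter; length; allFin; tabulate; replicate; foldr)
open import Data.List.Extrema.Nat using (v≤max⁺)
open import Data.List.Membership.Propositional using (_∈_; find; lose)
open import Data.List.Membership.Propositional.Properties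
  using (∈-tabulate⁺; ∈-map⁺; ∈-filter⁺; ∈-allFin)
open import Data.List.Properties using (map-cong; tabulate-cong; length-tabulate)
open import Data.List.Relation.Unary.All as All using (All; []; _∷_)
import Data.List.Relation.Unary.All.Properties as All
open import Data.List.Relation.Unary.Any as Any using (Any; here; there)
open import Data.Nat.Base as ℕ using (ℕ; zero; suc; NonZero; z≤n; s≤s)
import Data.Nat.Properties as ℕ
open import Data.Product.Base using (Σ-syntax; ∃-syntax; _×_; _,_; proj₁; proj₂)
open import Data.Rational.Base as ℚ using (ℚ; 0ℚ; 1ℚ; ½; _/_)
import Data.Rational.Properties as ℚ
open import Data.Rational.Solver using (module +-*-Solver)
import Data.Rational.Unnormalised.Base as ℚᵘ
import Data.Rational.Unnormalised.Properties as ℚᵘ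
open import Data.Sum.Base using (_⊎_; inj₁; inj₂; [_,_]′)
open import Data.Unit.Base using (⊤; tt)
open import Data.Vec.Base using ([]; _∷_)
open import Data.Vec.Functional using (updateAt)
open import Data.Vec.Functional.Properties using (updateAt-updates; updateAt-minimal)
open import Function.Base using (_∘_; id; const)
open import Level using (0ℓ)
open import Relation.Binary.Bundles using (Poset)
open import Relation.Binary.Core using (Rel)
open import Relation.Binary.Lattice.Definitions using (Supremum; Infimum)
open import Relation.Binary.PropositionalEquality as ≡
  using (_≡_; _≢_; _≗_; refl; cong; cong₂)
open import Relation.Binary.Structures using (IsPartialOrder)
open import Relation.Nullary.Decidable.Core using (yes; no; does; ¬?)
open import Relation.Nullary.Negation using (¬_; contradiction; ¬¬-map)
open import Relation.Unary using (Pred; Decidable)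
open import Defs

private variable
  A : Set
  n k s : ℕ

-- Order and addition on the reals.

infix 4 _⊑_ _≋_

-- _≤_ and _≈_ are Π-types that mention only the sequences of their arguments,
-- so Agda cannot recover the reals from a proof; a record makes this possible.
record _⊑_ (x y : ℝ) : Set where
  constructor ⟨_⟩
  field ⊑⇒≤ : x ≤ y

open _⊑_

_≋_ : ℝ → ℝ → Set
x ≋ y = x ⊑ y × y ⊑ x

p≤p+ε : ∀ p {ε} → 0ℚ ℚ.< ε → p ℚ.≤ p ℚ.+ ε
p≤p+ε p ε>0 = ≡.subst (ℚ._≤ p ℚ.+ _) (ℚ.+-identityʳ p) (ℚ.+-monoʳ-≤ p (ℚ.<⇒≤ ε>0))

pointwise-≤ : ∀ {x y} → (∀ n → seq x n ℚ.≤ seq y n) → x ⊑ y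
pointwise-≤ h = ⟨ (λ ε ε>0 → 0 , λ n _ → ℚ.≤-trans (h n) (p≤p+ε _ ε>0)) ⟩

pointwise-≡ : ∀ {x y} → (∀ n → seq x n ≡ seq y n) → x ≋ y
pointwise-≡ h = pointwise-≤ (λ n → ℚ.≤-reflexive (h n)) ,
                pointwise-≤ (λ n → ℚ.≤-reflexive (≡.sym (h n)))

⊑-refl : ∀ {x} → x ⊑ x
⊑-refl = pointwise-≤ (λ _ → ℚ.≤-refl)

⊑-trans : ∀ {x y z} → x ⊑ y → y ⊑ z → x ⊑ z
⊑-trans {x} {y} {z} ⟨ x≤y ⟩ ⟨ y≤z ⟩ = ⟨ bound ⟩
  where
  bound : x ≤ z
  bound ε ε>0 with x≤y (½ ℚ.* ε) (½ε>0 ε>0) | y≤z (½ ℚ.* ε) (½ε>0 ε>0)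
  ... | M , hx | N , hy = M ℕ.⊔ N , λ n ≤n → begin
    seq x n                               ≤⟨ hx n (ℕ.m⊔n≤o⇒m≤o M N ≤n) ⟩
    seq y n ℚ.+ ½ ℚ.* ε                   ≤⟨ ℚ.+-monoˡ-≤ _ (hy n (ℕ.m⊔n≤o⇒n≤o M N ≤n)) ⟩
    seq z n ℚ.+ ½ ℚ.* ε ℚ.+ ½ ℚ.* ε       ≡⟨ ℚ.+-assoc (seq z n) _ _ ⟩
    seq z n ℚ.+ (½ ℚ.* ε ℚ.+ ½ ℚ.* ε)     ≡⟨ cong (seq z n ℚ.+_) (½ε+½ε≡ε ε) ⟩
    seq z n ℚ.+ ε                         ∎
    where open ℚ.≤-Reasoning

⊑-poset : Poset 0ℓ 0ℓ 0ℓ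
⊑-poset = record
  { _≈_ = _≋_
  ; _≤_ = _⊑_
  ; isPartialOrder = record
    { isPreorder = record
      { isEquivalence = record
        { refl  = ⊑-refl , ⊑-refl
        ; sym   = λ (x⊑y , y⊑x) → y⊑x , x⊑y
        ; trans = λ (x⊑y , y⊑x) (y⊑z , z⊑y) → ⊑-trans x⊑y y⊑z , ⊑-trans z⊑y y⊑x
        }
      ; reflexive = proj₁
      ; trans     = ⊑-trans
      }
    ; antisym = _,_
    }
  }

module ⊑-Reasoning where
  open import Relation.Binary.Reasoning.PartialOrder ⊑-poset public

+-mono-⊑ : ∀ {x y u v} → x ⊑ y → u ⊑ v → x + u ⊑ y + v
+-mono-⊑ {x} {y} {u} {v} ⟨ x≤y ⟩ ⟨ u≤v ⟩ = ⟨ bound ⟩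
  where
  bound : x + u ≤ y + v
  bound ε ε>0 with x≤y (½ ℚ.* ε) (½ε>0 ε>0) | u≤v (½ ℚ.* ε) (½ε>0 ε>0)
  ... | M , hx | N , hu = M ℕ.⊔ N , λ n ≤n → begin
    seq x n ℚ.+ seq u n
      ≤⟨ ℚ.+-mono-≤ (hx n (ℕ.m⊔n≤o⇒m≤o M N ≤n)) (hu n (ℕ.m⊔n≤o⇒n≤o M N ≤n)) ⟩
    (seq y n ℚ.+ ½ ℚ.* ε) ℚ.+ (seq v n ℚ.+ ½ ℚ.* ε)
      ≡⟨ solve 3 (λ a b e → (a :+ e) :+ (b :+ e) := (a :+ b) :+ (e :+ e))
           refl (seq y n) (seq v n) (½ ℚ.* ε) ⟩
    (seq y n ℚ.+ seq v n) ℚ.+ (½ ℚ.* ε ℚ.+ ½ ℚ.* ε)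
      ≡⟨ cong ((seq y n ℚ.+ seq v n) ℚ.+_) (½ε+½ε≡ε ε) ⟩
    (seq y n ℚ.+ seq v n) ℚ.+ ε ∎
    where
    open ℚ.≤-Reasoning
    open +-*-Solver

·-monoʳ-⊑ : ∀ q .{{_ : ℚ.NonNegative q}} {x y} → x ⊑ y → q · x ⊑ q · y
·-monoʳ-⊑ q {x} {y} ⟨ x≤y ⟩ = ⟨ bound ⟩
  where
  bound : q · x ≤ q · y
  bound ε ε>0 = let (δ , δ>0 , ∣q∣δ≤ε) = ∃δ>0-∣q∣δ≤ε q ε ε>0 in scale δ ∣q∣δ≤ε (x≤y δ δ>0)
    where
    open ℚ.≤-Reasoning
    scale : ∀ δ → ℚ.∣ q ∣ ℚ.* δ ℚ.≤ ε →
            ∃[ N ] (∀ n → N ℕ.≤ n → seq x n ℚ.≤ seq y n ℚ.+ δ) →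
            ∃[ N ] (∀ n → N ℕ.≤ n → q ℚ.* seq x n ℚ.≤ q ℚ.* seq y n ℚ.+ ε)
    scale δ ∣q∣δ≤ε (N , h) = N , λ n ≤n → begin
      q ℚ.* seq x n                    ≤⟨ ℚ.*-monoˡ-≤-nonNeg q (h n ≤n) ⟩
      q ℚ.* (seq y n ℚ.+ δ)            ≡⟨ ℚ.*-distribˡ-+ q (seq y n) δ ⟩
      q ℚ.* seq y n ℚ.+ q ℚ.* δ        ≤⟨ ℚ.+-monoʳ-≤ (q ℚ.* seq y n) qδ≤ε ⟩
      q ℚ.* seq y n ℚ.+ ε              ∎
      where
      qδ≤ε : q ℚ.* δ ℚ.≤ ε
      qδ≤ε = ≡.subst (λ r → r ℚ.* δ ℚ.≤ ε) (ℚ.0≤p⇒∣p∣≡p (ℚ.nonNegative⁻¹ q)) ∣q∣δ≤ε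

+-commutativeMonoid : CommutativeMonoid 0ℓ 0ℓ
+-commutativeMonoid = record
  { _≈_ = _≋_
  ; _∙_ = _+_
  ; ε   = 0ℝ
  ; isCommutativeMonoid = record
    { isMonoid = record
      { isSemigroup = record
        { isMagma = record
          { isEquivalence = Poset.isEquivalence ⊑-poset
          ; ∙-cong = λ (p , p′) (q , q′) → +-mono-⊑ p q , +-mono-⊑ p′ q′
          }
        ; assoc = λ x y z → pointwise-≡ λ n → ℚ.+-assoc (seq x n) (seq y n) (seq z n)
        }
      ; identity = (λ x → pointwise-≡ λ n → ℚ.+-identityˡ (seq x n))
                 , (λ x → pointwise-≡ λ n → ℚ.+-identityʳ (seq x n))
      }
    ; comm = λ x y → pointwise-≡ λ n → ℚ.+-comm (seq x n) (seq y n)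
    }
  }

+-cancelʳ-⊑ : ∀ {x y} z → x + z ⊑ y + z → x ⊑ y
+-cancelʳ-⊑ {x} {y} z ⟨ h ⟩ = ⟨ bound ⟩
  where
  bound : x ≤ y
  bound ε ε>0 with h ε ε>0
  ... | N , h′ = N , λ n ≤n → begin
    seq x n
      ≡⟨ solve 2 (λ a c → a := (a :+ c) :- c) refl (seq x n) (seq z n) ⟩
    (seq x n ℚ.+ seq z n) ℚ.- seq z n
      ≤⟨ ℚ.+-monoˡ-≤ (ℚ.- seq z n) (h′ n ≤n) ⟩
    (seq y n ℚ.+ seq z n ℚ.+ ε) ℚ.- seq z n
      ≡⟨ solve 3 (λ b c e → ((b :+ c) :+ e) :- c := b :+ e) refl (seq y n) (seq z n) ε ⟩
    seq y n ℚ.+ ε ∎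
    where
    open ℚ.≤-Reasoning
    open +-*-Solver

x+x⊑y+y⇒x⊑y : ∀ {x y} → x + x ⊑ y + y → x ⊑ y
x+x⊑y+y⇒x⊑y {x} {y} h = begin
  x             ≈⟨ halve x ⟨
  ½ · (x + x)   ≤⟨ ·-monoʳ-⊑ ½ h ⟩
  ½ · (y + y)   ≈⟨ halve y ⟩
  y             ∎
  where
  open ⊑-Reasoning
  halve : ∀ x → ½ · (x + x) ≋ x
  halve x = pointwise-≡ λ n → ≡.trans (ℚ.*-distribˡ-+ ½ (seq x n) (seq x n)) (½ε+½ε≡ε (seq x n))

-- Approximate comparison, stability and minima of reals.

-- The constructive strict order: the gap `δ` is uniform along a tail, so it survives in the limit.
Eventually> : ℝ → ℝ → Set
Eventually> x y = ∃[ δ ] (0ℚ ℚ.< δ × ∃[ N ] (∀ n → N ℕ.≤ n → seq y n ℚ.+ δ ℚ.≤ seq x n))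

-- A single rational comparison, at an index beyond both Cauchy moduli, decides; the moduli carry
-- its outcome to the whole tail.
eventually-≤-or-> : ∀ x y ε → 0ℚ ℚ.< ε →
  (∃[ N ] (∀ n → N ℕ.≤ n → seq x n ℚ.≤ seq y n ℚ.+ ε)) ⊎ Eventually> x y
eventually-≤-or-> x y ε ε>0 =
  -- With `η = ε/8` the test compares `x` with `y + 4η`. Moving both sequences along the tail costs
  -- `2η`: success leaves a slack of `6η`, within `ε`, and failure a gap of at least `η`.
  decide (½ ℚ.* (½ ℚ.* (½ ℚ.* ε))) (½ε>0 (½ε>0 (½ε>0 ε>0))) 8η≡ε
  where
  open ℚ.≤-Reasoning
  open +-*-Solver
  double : ℚ → ℚ
  double p = p ℚ.+ p
  8η≡ε : double (double (double (½ ℚ.* (½ ℚ.* (½ ℚ.* ε))))) ≡ ε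
  8η≡ε = ≡.trans
    (cong double (≡.trans (cong double (½ε+½ε≡ε (½ ℚ.* (½ ℚ.* ε)))) (½ε+½ε≡ε (½ ℚ.* ε))))
    (½ε+½ε≡ε ε)
  decide : ∀ η → 0ℚ ℚ.< η → double (double (double η)) ≡ ε → _
  decide η η>0 8η≡ε with cauchy x η η>0 | cauchy y η η>0
  ... | M , hx | N , hy with seq x (M ℕ.⊔ N) ℚ.≤? seq y (M ℕ.⊔ N) ℚ.+ double (double η)
  ... | yes x≤y+4η = inj₁ (L , λ n ≤n → begin
    seq x n
      ≤⟨ ∣p-q∣≤ε⇒p≤q+ε _ (seq x L) (hx n L (ℕ.m⊔n≤o⇒m≤o M N ≤n) (ℕ.m≤m⊔n M N)) ⟩
    seq x L ℚ.+ η
      ≤⟨ ℚ.+-monoˡ-≤ η x≤y+4η ⟩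
    seq y L ℚ.+ double (double η) ℚ.+ η
      ≤⟨ ℚ.+-monoˡ-≤ η (ℚ.+-monoˡ-≤ (double (double η))
           (∣p-q∣≤ε⇒p≤q+ε (seq y L) (seq y n) (hy L n (ℕ.m≤n⊔m M N) (ℕ.m⊔n≤o⇒n≤o M N ≤n)))) ⟩
    seq y n ℚ.+ η ℚ.+ double (double η) ℚ.+ η
      -- The slack `6η` is padded to `8η`, which equals `ε`.
      ≤⟨ p≤p+ε _ η>0 ⟩
    seq y n ℚ.+ η ℚ.+ double (double η) ℚ.+ η ℚ.+ η
      ≤⟨ p≤p+ε _ η>0 ⟩
    seq y n ℚ.+ η ℚ.+ double (double η) ℚ.+ η ℚ.+ η ℚ.+ η
      ≡⟨ solve 2 (λ y η → y :+ η :+ ((η :+ η) :+ (η :+ η)) :+ η :+ η :+ η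
                 := y :+ (((η :+ η) :+ (η :+ η)) :+ ((η :+ η) :+ (η :+ η)))) refl (seq y n) η ⟩
    seq y n ℚ.+ double (double (double η))
      ≡⟨ cong (seq y n ℚ.+_) 8η≡ε ⟩
    seq y n ℚ.+ ε ∎)
    where L = M ℕ.⊔ N
  ... | no x≰y+4η = inj₂ (η , η>0 , L , λ n ≤n → begin
    seq y n ℚ.+ η
      ≤⟨ ℚ.+-monoˡ-≤ η
           (∣p-q∣≤ε⇒p≤q+ε (seq y n) (seq y L) (hy n L (ℕ.m⊔n≤o⇒n≤o M N ≤n) (ℕ.m≤n⊔m M N))) ⟩
    seq y L ℚ.+ η ℚ.+ η
      ≤⟨ p≤p+ε _ η>0 ⟩
    seq y L ℚ.+ η ℚ.+ η ℚ.+ η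
      ≡⟨ solve 2 (λ y η → y :+ η :+ η :+ η := y :+ ((η :+ η) :+ (η :+ η)) :- η)
           refl (seq y L) η ⟩
    seq y L ℚ.+ double (double η) ℚ.- η
      ≤⟨ p≤q+ε⇒p-q≤ε _ η {seq x n} (begin
           seq y L ℚ.+ double (double η)   ≤⟨ ℚ.<⇒≤ (ℚ.≰⇒> x≰y+4η) ⟩
           seq x L                         ≤⟨ ∣p-q∣≤ε⇒p≤q+ε _ (seq x n)
                                                (hx L n (ℕ.m≤m⊔n M N) (ℕ.m⊔n≤o⇒m≤o M N ≤n)) ⟩
           seq x n ℚ.+ η                   ≡⟨ ℚ.+-comm (seq x n) η ⟩
           η ℚ.+ seq x n                   ∎) ⟩
    seq x n ∎)
    where L = M ℕ.⊔ N

-- For each `ε` the approximate comparison yields either the required tail or a positive gap, and a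
-- gap refutes `x ⊑ y`.
⊑-stable : ∀ {x y} → ¬ ¬ x ⊑ y → x ⊑ y
⊑-stable {x} {y} ¬¬x⊑y = ⟨ (λ ε ε>0 → [ id , (λ x>y → contradiction (impossible x>y) ¬¬x⊑y) ]′
                             (eventually-≤-or-> x y ε ε>0)) ⟩
  where
  open ℚ.≤-Reasoning
  impossible : Eventually> x y → ¬ x ⊑ y
  impossible (δ , δ>0 , M , y+δ≤x) ⟨ x≤y ⟩ =
    let (N , x≤y+½δ) = x≤y (½ ℚ.* δ) (½ε>0 δ>0); L = M ℕ.⊔ N in
    ℚ.<-irrefl refl (begin-strict
      seq y L ℚ.+ δ          ≤⟨ y+δ≤x L (ℕ.m≤m⊔n M N) ⟩
      seq x L                ≤⟨ x≤y+½δ L (ℕ.m≤n⊔m M N) ⟩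
      seq y L ℚ.+ ½ ℚ.* δ    <⟨ ℚ.+-monoʳ-< (seq y L) ½δ<δ ⟩
      seq y L ℚ.+ δ          ∎)
    where
    ½δ<δ : ½ ℚ.* δ ℚ.< δ
    ½δ<δ = begin-strict
      ½ ℚ.* δ                ≡⟨ ℚ.+-identityˡ (½ ℚ.* δ) ⟨
      0ℚ ℚ.+ ½ ℚ.* δ         <⟨ ℚ.+-monoˡ-< (½ ℚ.* δ) (½ε>0 δ>0) ⟩
      ½ ℚ.* δ ℚ.+ ½ ℚ.* δ    ≡⟨ ½ε+½ε≡ε δ ⟩
      δ                      ∎

-- Stands in for totality of the order: a positive gap of `y` over `x` would already prove `x ⊑ y`,
-- so each `ε` falls in the other alternative.
⋢⇒⊒ : ∀ {x y} → ¬ x ⊑ y → y ⊑ x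
⋢⇒⊒ {x} {y} x⋢y = ⟨ (λ ε ε>0 → [ id , (λ y>x → contradiction (below y>x) x⋢y) ]′
                      (eventually-≤-or-> y x ε ε>0)) ⟩
  where
  below : Eventually> y x → x ⊑ y
  below (δ , δ>0 , N , x+δ≤y) = ⟨ (λ ε ε>0 → N , λ n ≤n →
    ℚ.≤-trans (p≤p+ε (seq x n) δ>0) (ℚ.≤-trans (x+δ≤y n ≤n) (p≤p+ε (seq y n) ε>0))) ⟩

-- As − max (− x , − y), so that the Cauchy property is inherited from ⊔.
_⊓_ : ℝ → ℝ → ℝ
x ⊓ y = ℚ.- 1ℚ · (ℚ.- 1ℚ · x ⊔ ℚ.- 1ℚ · y)

seq-⊓ : ∀ x y n → seq (x ⊓ y) n ≡ seq x n ℚ.⊓ seq y n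
seq-⊓ x y n = ≡.trans (ℚ.*-distribˡ-⊔-nonPos (ℚ.- 1ℚ) (ℚ.- 1ℚ ℚ.* seq x n) (ℚ.- 1ℚ ℚ.* seq y n))
  (≡.cong₂ ℚ._⊓_ (involutive (seq x n)) (involutive (seq y n)))
  where
  open +-*-Solver
  involutive : ∀ p → ℚ.- 1ℚ ℚ.* (ℚ.- 1ℚ ℚ.* p) ≡ p
  involutive = solve 1 (λ p → con (ℚ.- 1ℚ) :* (con (ℚ.- 1ℚ) :* p) := p) refl

x⊓y⊑x : ∀ x y → x ⊓ y ⊑ x
x⊓y⊑x x y = pointwise-≤ λ n →
  ≡.subst (ℚ._≤ seq x n) (≡.sym (seq-⊓ x y n)) (ℚ.p⊓q≤p (seq x n) (seq y n))

x⊓y⊑y : ∀ x y → x ⊓ y ⊑ y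
x⊓y⊑y x y = pointwise-≤ λ n →
  ≡.subst (ℚ._≤ seq y n) (≡.sym (seq-⊓ x y n)) (ℚ.p⊓q≤q (seq x n) (seq y n))

⊓-glb : ∀ {x y z} → z ⊑ x → z ⊑ y → z ⊑ x ⊓ y
⊓-glb {x} {y} {z} ⟨ z≤x ⟩ ⟨ z≤y ⟩ = ⟨ bound ⟩
  where
  bound : z ≤ x ⊓ y
  bound ε ε>0 =
    let (M , hx) = z≤x ε ε>0
        (N , hy) = z≤y ε ε>0
    in M ℕ.⊔ N , λ n ≤n →
      ≡.subst (λ p → seq z n ℚ.≤ p ℚ.+ ε) (≡.sym (seq-⊓ x y n))
        (below n (hx n (ℕ.m⊔n≤o⇒m≤o M N ≤n)) (hy n (ℕ.m⊔n≤o⇒n≤o M N ≤n)))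
    where
    below : ∀ n → seq z n ℚ.≤ seq x n ℚ.+ ε → seq z n ℚ.≤ seq y n ℚ.+ ε →
            seq z n ℚ.≤ (seq x n ℚ.⊓ seq y n) ℚ.+ ε
    below n hx hy = [ (λ e → ≡.subst (λ p → seq z n ℚ.≤ p ℚ.+ ε) (≡.sym e) hx)
                    , (λ e → ≡.subst (λ p → seq z n ℚ.≤ p ℚ.+ ε) (≡.sym e) hy)
                    ]′ (ℚ.⊓-sel (seq x n) (seq y n))

-- Division by a natural number.

-- Since `_/_` reduces fractions, the identity is checked on unnormalised rationals, where it is a
-- cross-multiplication of integers.
1/k+n/k≡[1+n]/k : ∀ n k .{{_ : NonZero k}} → + 1 / k ℚ.+ + n / k ≡ + suc n / k
1/k+n/k≡[1+n]/k n (suc k) = ℚ.toℚᵘ-injective (begin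
  ℚ.toℚᵘ (+ 1 / suc k ℚ.+ + n / suc k)
    ≈⟨ ℚ.toℚᵘ-homo-+ (+ 1 / suc k) (+ n / suc k) ⟩
  ℚ.toℚᵘ (+ 1 / suc k) ℚᵘ.+ ℚ.toℚᵘ (+ n / suc k)
    ≈⟨ ℚᵘ.+-cong (ℚ.toℚᵘ-fromℚᵘ (ℚᵘ.mkℚᵘ (+ 1) k)) (ℚ.toℚᵘ-fromℚᵘ (ℚᵘ.mkℚᵘ (+ n) k)) ⟩
  ℚᵘ.mkℚᵘ (+ 1) k ℚᵘ.+ ℚᵘ.mkℚᵘ (+ n) k
    ≈⟨ ℚᵘ.*≡* (solve 2 (λ n d → (con (+ 1) :* d :+ n :* d) :* d := (con (+ 1) :+ n) :* (d :* d))
                refl (+ n) (+ suc k)) ⟩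
  ℚᵘ.mkℚᵘ (+ suc n) k
    ≈⟨ ℚ.toℚᵘ-fromℚᵘ (ℚᵘ.mkℚᵘ (+ suc n) k) ⟨
  ℚ.toℚᵘ (+ suc n / suc k) ∎)
  where
  open ℚᵘ.≃-Reasoning
  open ℤ.+-*-Solver

k/k≡1 : ∀ k .{{_ : NonZero k}} → + k / k ≡ 1ℚ
k/k≡1 (suc k) = ℚ.fromℚᵘ-cong {ℚᵘ.mkℚᵘ (+ suc k) k} {ℚᵘ.1ℚᵘ} (ℚᵘ.*≡* (ℤ.*-comm (+ suc k) (+ 1)))

0/k≡0 : ∀ k .{{_ : NonZero k}} → + 0 / k ≡ 0ℚ
0/k≡0 (suc k) = ℚ.fromℚᵘ-cong {ℚᵘ.mkℚᵘ (+ 0) k} {ℚᵘ.0ℚᵘ} (ℚᵘ.*≡* refl)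

-- Stated for an arbitrary progression r, because unfolding _/_ is expensive.
module _ (q : ℚ) .{{_ : ℚ.NonNegative q}} (r : ℕ → ℚ)
         (r₀≡0 : r 0 ≡ 0ℚ) (r-step : ∀ n → q ℚ.+ r n ≡ r (suc n)) where

  ·-replicate : ∀ n x → q · sumℝ (replicate n x) ≋ r n · x
  ·-replicate n x = pointwise-≡ (go n)
    where
    open ≡.≡-Reasoning
    go : ∀ n m → q ℚ.* seq (sumℝ (replicate n x)) m ≡ r n ℚ.* seq x m
    go zero m = begin
      q ℚ.* 0ℚ            ≡⟨ ℚ.*-zeroʳ q ⟩
      0ℚ                  ≡⟨ ℚ.*-zeroˡ (seq x m) ⟨
      0ℚ ℚ.* seq x m      ≡⟨ cong (ℚ._* seq x m) r₀≡0 ⟨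
      r 0 ℚ.* seq x m     ∎
    go (suc n) m = begin
      q ℚ.* (seq x m ℚ.+ seq (sumℝ (replicate n x)) m)
        ≡⟨ ℚ.*-distribˡ-+ q (seq x m) (seq (sumℝ (replicate n x)) m) ⟩
      q ℚ.* seq x m ℚ.+ q ℚ.* seq (sumℝ (replicate n x)) m
        ≡⟨ cong (q ℚ.* seq x m ℚ.+_) (go n m) ⟩
      q ℚ.* seq x m ℚ.+ r n ℚ.* seq x m
        ≡⟨ ℚ.*-distribʳ-+ (seq x m) q (r n) ⟨
      (q ℚ.+ r n) ℚ.* seq x m
        ≡⟨ cong (ℚ._* seq x m) (r-step n) ⟩
      r (suc n) ℚ.* seq x m ∎

  -- The progression forces `r n` to be `n` times `q`, so scaling both sides by `q` turns the `k`
  -- copies of `x` into `x` itself.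
  replicate-cancel-⊑ : ∀ k n {x y} → r k ≡ 1ℚ →
                       sumℝ (replicate k x) ⊑ sumℝ (replicate n y) → x ⊑ r n · y
  replicate-cancel-⊑ k n {x} {y} rₖ≡1 kx⊑ny = begin
    x                            ≈⟨ pointwise-≡ {r k · x} {x} 1x≡x ⟨
    r k · x                      ≈⟨ ·-replicate k x ⟨
    q · sumℝ (replicate k x)     ≤⟨ ·-monoʳ-⊑ q {sumℝ (replicate k x)} {sumℝ (replicate n y)} kx⊑ny ⟩
    q · sumℝ (replicate n y)     ≈⟨ ·-replicate n y ⟩
    r n · y                      ∎
    where
    open ⊑-Reasoning
    1x≡x : ∀ m → r k ℚ.* seq x m ≡ seq x m
    1x≡x m = ≡.trans (cong (ℚ._* seq x m) rₖ≡1) (ℚ.*-identityˡ (seq x m))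

-- Instances are passed by hand: while they are unsolved, comparing two
-- occurrences of (+ n / k) · y unfolds the Cauchy proofs.
replicate-⊑⇒⊑/ : ∀ k n .{{_ : NonZero k}} {x y} →
                 sumℝ (replicate k x) ⊑ sumℝ (replicate n y) → x ⊑ (+ n / k) · y
replicate-⊑⇒⊑/ k n {{k≢0}} {x} {y} =
  replicate-cancel-⊑ ((+ 1 / k) {{k≢0}}) {{ℚ.normalize-nonNeg 1 k {{k≢0}}}} (λ n → (+ n / k) {{k≢0}})
    (0/k≡0 k {{k≢0}}) (λ n → 1/k+n/k≡[1+n]/k n k {{k≢0}}) k n {x} {y} (k/k≡1 k {{k≢0}})

-- Degrees and the number of colours used.

degree≤Δ : (G : Graph n) → ∀ v → Graph.degree G v ℕ.≤ Δ G
degree≤Δ G v = v≤max⁺ 0 (tabulate degree) (inj₂ (lose (∈-tabulate⁺ v) ℕ.≤-refl))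
  where open Graph G

∣p∪q∣≤∣p∣+∣q∣ : (p q : Subset n) → ∣ p ∪ q ∣ ℕ.≤ ∣ p ∣ ℕ.+ ∣ q ∣
∣p∪q∣≤∣p∣+∣q∣ []            []            = z≤n
∣p∪q∣≤∣p∣+∣q∣ (outside ∷ p) (outside ∷ q) = ∣p∪q∣≤∣p∣+∣q∣ p q
∣p∪q∣≤∣p∣+∣q∣ (outside ∷ p) (inside  ∷ q) =
  ≡.subst (suc ∣ p ∪ q ∣ ℕ.≤_) (≡.sym (ℕ.+-suc ∣ p ∣ ∣ q ∣)) (s≤s (∣p∪q∣≤∣p∣+∣q∣ p q))
∣p∪q∣≤∣p∣+∣q∣ (inside  ∷ p) (outside ∷ q) = s≤s (∣p∪q∣≤∣p∣+∣q∣ p q)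
∣p∪q∣≤∣p∣+∣q∣ (inside  ∷ p) (inside  ∷ q) =
  s≤s (ℕ.≤-trans (∣p∪q∣≤∣p∣+∣q∣ p q) (ℕ.+-monoʳ-≤ ∣ p ∣ (ℕ.n≤1+n ∣ q ∣)))

∣⋃⁅⁆∣≤length : (xs : List (Fin s)) → ∣ ⋃ (map ⁅_⁆ xs) ∣ ℕ.≤ length xs
∣⋃⁅⁆∣≤length {s} []       = ℕ.≤-reflexive (∣⊥∣≡0 s)
∣⋃⁅⁆∣≤length     (x ∷ xs) = begin
  ∣ ⁅ x ⁆ ∪ ⋃ (map ⁅_⁆ xs) ∣         ≤⟨ ∣p∪q∣≤∣p∣+∣q∣ ⁅ x ⁆ (⋃ (map ⁅_⁆ xs)) ⟩
  ∣ ⁅ x ⁆ ∣ ℕ.+ ∣ ⋃ (map ⁅_⁆ xs) ∣   ≡⟨ cong (ℕ._+ _) (∣⁅x⁆∣≡1 x) ⟩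
  suc ∣ ⋃ (map ⁅_⁆ xs) ∣             ≤⟨ s≤s (∣⋃⁅⁆∣≤length xs) ⟩
  suc (length xs)                    ∎
  where open ℕ.≤-Reasoning

⋃-least : ∀ {ps : List (Subset s)} {q} → All (_⊆ q) ps → ⋃ ps ⊆ q
⋃-least {q = q} []      = ⊆-min q
⋃-least {ps = p ∷ ps}  (p⊆q ∷ ps⊆q) x∈ = [ p⊆q , ⋃-least ps⊆q ]′ (x∈p∪q⁻ p (⋃ ps) x∈)

p∈ps⇒p⊆⋃ps : ∀ {p : Subset s} {ps} → p ∈ ps → p ⊆ ⋃ ps
p∈ps⇒p⊆⋃ps {ps = q ∷ ps} (here refl)  = p⊆p∪q (⋃ ps)
p∈ps⇒p⊆⋃ps {ps = q ∷ ps} (there p∈ps) = ⊆-trans (p∈ps⇒p⊆⋃ps p∈ps) (q⊆p∪q q (⋃ ps))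

-- All colours used lie in the image of `ι`, a union of `k` singletons.
∘-isColouringWith : (ι : Fin k → Fin s) (c : Colouring n k) → IsColouringWith k (ι ∘ c)
∘-isColouringWith {k} ι c = begin
  ∣ coloursUsed (ι ∘ c) ∣             ≤⟨ p⊆q⇒∣p∣≤∣q∣ (⋃-least (All.tabulate⁺ λ v →
                                           p∈ps⇒p⊆⋃ps (∈-map⁺ ⁅_⁆ (∈-tabulate⁺ (c v))))) ⟩
  ∣ ⋃ (map ⁅_⁆ (tabulate ι)) ∣        ≤⟨ ∣⋃⁅⁆∣≤length (tabulate ι) ⟩
  length (tabulate ι)                 ≡⟨ length-tabulate ι ⟩
  k                                   ∎
  where open ℕ.≤-Reasoning

coloursUsed-cong : {c d : Colouring n s} → c ≗ d → coloursUsed c ≡ coloursUsed d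
coloursUsed-cong c≗d = cong ⋃ (tabulate-cong (cong ⁅_⁆ ∘ c≗d))

-- Extrema, sums and the potential argument over an ordered monoid.

-- Collects what the potential argument asks of the reals: cancellation and halving replace
-- subtraction and division by two, and `⋠⇒≽` replaces totality.
record IsOrderedMonoid {R : Set} (_≃_ _≼_ : Rel R 0ℓ) (_⊕_ _∨_ _∧_ : Op₂ R) (0# : R) : Set where
  field
    isCommutativeMonoid : IsCommutativeMonoid _≃_ _⊕_ 0#
    isPartialOrder      : IsPartialOrder _≃_ _≼_
    ⊕-mono-≼            : ∀ {x y u v} → x ≼ y → u ≼ v → (x ⊕ u) ≼ (y ⊕ v)
    ⊕-cancelʳ-≼         : ∀ {x y} z → (x ⊕ z) ≼ (y ⊕ z) → x ≼ y
    halve-≼             : ∀ {x y} → (x ⊕ x) ≼ (y ⊕ y) → x ≼ y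
    supremum            : Supremum _≼_ _∨_
    infimum             : Infimum _≼_ _∧_
    ⋠⇒≽                 : ∀ {x y} → ¬ (x ≼ y) → y ≼ x

-- The operations of ℝ unfold to Cauchy proofs, which makes unification
-- intractable; over an abstract carrier they are neutral.
module OrderedMonoid
  {R : Set} {_≃_ _≼_ : Rel R 0ℓ} {_⊕_ _∨_ _∧_ : Op₂ R} {0# : R}
  (isOrderedMonoid : IsOrderedMonoid _≃_ _≼_ _⊕_ _∨_ _∧_ 0#)
  where

  open IsOrderedMonoid isOrderedMonoid
  open IsCommutativeMonoid isCommutativeMonoid using ()
    renaming (∙-cong to ⊕-cong; ∙-congˡ to ⊕-congˡ; ∙-congʳ to ⊕-congʳ;
              assoc to ⊕-assoc; identityˡ to ⊕-identityˡ)
  open IsPartialOrder isPartialOrder using (module Eq)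
    renaming (refl to ≼-refl; trans to ≼-trans; reflexive to ≼-reflexive)

  private
    commutativeMonoid : CommutativeMonoid 0ℓ 0ℓ
    commutativeMonoid = record { isCommutativeMonoid = isCommutativeMonoid }

    poset : Poset 0ℓ 0ℓ 0ℓ
    poset = record { isPartialOrder = isPartialOrder }

  open import Algebra.Properties.CommutativeMonoid.Sum commutativeMonoid
    using (sum; sum-cong-≋; sum-cong-≗; sum-remove; ∑-distrib-+; sum-replicate-zero)
  open import Relation.Binary.Reasoning.PartialOrder poset

  ∑ max : List R → R
  ∑   = foldr _⊕_ 0#
  max = foldr _∨_ 0#

  0≼max : ∀ xs → 0# ≼ max xs
  0≼max []       = ≼-refl
  0≼max (x ∷ xs) = ≼-trans (0≼max xs) (proj₁ (proj₂ (supremum x (max xs))))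

  x∈xs⇒x≼max : ∀ {x xs} → x ∈ xs → x ≼ max xs
  x∈xs⇒x≼max {xs = y ∷ xs} (here refl)  = proj₁ (supremum y (max xs))
  x∈xs⇒x≼max {xs = y ∷ xs} (there x∈xs) =
    ≼-trans (x∈xs⇒x≼max x∈xs) (proj₁ (proj₂ (supremum y (max xs))))

  max-lub : ∀ {t xs} → 0# ≼ t → All (_≼ t) xs → max xs ≼ t
  max-lub                0≼t []           = 0≼t
  max-lub {xs = x ∷ xs} 0≼t (x≼t ∷ xs≼t) =
    proj₂ (proj₂ (supremum x (max xs))) _ x≼t (max-lub 0≼t xs≼t)

  -- The double negation is needed because ≼ may be undecidable.
  ∃-minimum : (f : A → R) (x : A) (xs : List A) →
    ∃[ m ] (All (λ y → m ≼ f y) (x ∷ xs) × ¬ ¬ Any (λ y → f y ≼ m) (x ∷ xs))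
  ∃-minimum f x []       = f x , (≼-refl ∷ []) , contradiction (here ≼-refl)
  ∃-minimum f x (y ∷ ys) =
    let (m , lower , attained) = ∃-minimum f y ys
        (∧≼fx , ∧≼m , ∧-glb)   = infimum (f x) m
    in f x ∧ m , ∧≼fx ∷ All.map (≼-trans ∧≼m) lower ,
       λ ¬attained → attained λ any →
         -- If `f x ≼ m` held, `x` would attain the meet. Hence `m ≼ f x`, and whatever attains `m`
         -- in the tail attains the meet.
         let m≼fx = ⋠⇒≽ (λ fx≼m → ¬attained (here (∧-glb (f x) ≼-refl fx≼m)))
         in ¬attained (there (Any.map (λ fz≼m → ≼-trans fz≼m (∧-glb m m≼fx ≼-refl)) any))

  -- Colourings are functions, hence enumerable only up to pointwise equality; this is why `P` and
  -- `f` must respect `_≗_`. The seed `c₀` makes the list of candidates non-empty.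
  ∃-minimum-colouring : {P : Pred (Colouring n s) 0ℓ} (P? : Decidable P) →
    (∀ {c d} → c ≗ d → P c → P d) →
    (f : Colouring n s → R) → (∀ {c d} → c ≗ d → f c ≡ f d) →
    ∀ c₀ → P c₀ →
    ∃[ m ] ((∀ c → P c → m ≼ f c) × ¬ ¬ (∃[ c ] (P c × f c ≼ m)))
  ∃-minimum-colouring {n} {s} {P} P? P-resp f f-cong c₀ Pc₀ =
    let (m , lower , attained) = ∃-minimum f c₀ cs
    in m
     -- The list contains the decoded code of `c` rather than `c`, and `f-cong` transfers the bound.
     , (λ c Pc → ≡.subst (m ≼_) (f-cong (Fin.finToFun-funToFin c))
                   (All.lookup (All.tail lower) (code∈cs Pc)))
     , ¬¬-map (λ any → let (c , c∈ , fc≼m) = find any in c , All.lookup all-P c∈ , fc≼m) attained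
    where
    cs : List (Colouring n s)
    cs = filter P? (map finToFun (allFin (s ℕ.^ n)))
    all-P : All P (c₀ ∷ cs)
    all-P = Pc₀ ∷ All.all-filter P? (map finToFun (allFin (s ℕ.^ n)))
    code∈cs : ∀ {c} → P c → finToFun (funToFin c) ∈ cs
    code∈cs {c} Pc = ∈-filter⁺ P? (∈-map⁺ finToFun (∈-allFin (funToFin c)))
                       (P-resp (≡.sym ∘ Fin.finToFun-funToFin c) Pc)

  -- Finite sums.

  0≼∑-replicate : ∀ n {x} → 0# ≼ x → 0# ≼ ∑ (replicate n x)
  0≼∑-replicate zero    0≼x = ≼-refl
  0≼∑-replicate (suc n) 0≼x =
    ≼-trans (≼-reflexive (Eq.sym (⊕-identityˡ 0#))) (⊕-mono-≼ 0≼x (0≼∑-replicate n 0≼x))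

  ∑-replicate-monoˡ : ∀ {m n x} → 0# ≼ x → m ℕ.≤ n → ∑ (replicate m x) ≼ ∑ (replicate n x)
  ∑-replicate-monoˡ {n = n} 0≼x z≤n       = 0≼∑-replicate n 0≼x
  ∑-replicate-monoˡ         0≼x (s≤s m≤n) = ⊕-mono-≼ ≼-refl (∑-replicate-monoˡ 0≼x m≤n)

  sum-mono-≼ : {f g : Fin n → R} → (∀ i → f i ≼ g i) → sum f ≼ sum g
  sum-mono-≼ {zero}  f≼g = ≼-refl
  sum-mono-≼ {suc n} f≼g = ⊕-mono-≼ (f≼g zero) (sum-mono-≼ (f≼g ∘ suc))

  sum-const : ∀ n x → sum {n} (λ _ → x) ≡ ∑ (replicate n x)
  sum-const zero    x = refl
  sum-const (suc n) x = cong₂ _⊕_ refl (sum-const n x)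

  0≼sum : {f : Fin n → R} → (∀ i → 0# ≼ f i) → 0# ≼ sum f
  0≼sum {n} 0≼f = ≼-trans (≼-reflexive (Eq.sym (sum-replicate-zero n))) (sum-mono-≼ 0≼f)

  -- The terms beyond the first `k` are non-negative; for interferences, this compares a row
  -- restricted to the chosen colours with the full row.
  sum-inject≤-≼ : .(k≤s : k ℕ.≤ s) {f : Fin s → R} → (∀ i → 0# ≼ f i) →
                  sum (λ i → f (inject≤ {k} i k≤s)) ≼ sum f
  sum-inject≤-≼ {zero}          k≤s 0≼f = 0≼sum 0≼f
  sum-inject≤-≼ {suc k} {suc s} k≤s 0≼f = ⊕-mono-≼ ≼-refl (sum-inject≤-≼ (ℕ.s≤s⁻¹ k≤s) (0≼f ∘ suc))

  ∑-tabulate : (f : Fin n → R) → ∑ (tabulate f) ≡ sum f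
  ∑-tabulate {zero}  f = refl
  ∑-tabulate {suc n} f = cong₂ _⊕_ refl (∑-tabulate (f ∘ suc))

  ∑-filter : {P : Pred A 0ℓ} (P? : Decidable P) (f : A → R) (g : Fin n → A) →
    ∑ (map f (filter P? (tabulate g))) ≃ sum (λ i → if does (P? (g i)) then f (g i) else 0#)
  ∑-filter {n = zero}  P? f g = Eq.refl
  ∑-filter {n = suc n} P? f g with does (P? (g zero))
  ... | true  = ⊕-congˡ (∑-filter P? f (g ∘ suc))
  ... | false = Eq.trans (∑-filter P? f (g ∘ suc)) (Eq.sym (⊕-identityˡ _))

  -- Exchanges the two summations one list element at a time, so that each element contributes one
  -- sum `sum (g x)`, bounded by `B`.
  sum-∑-≼ : ∀ {B} (g : A → Fin n → R) (xs : List A) → (∀ x → sum (g x) ≼ B) →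
               sum (λ i → ∑ (map (λ x → g x i) xs)) ≼ ∑ (replicate (length xs) B)
  sum-∑-≼ {n = n} g []       g≼B = ≼-reflexive (sum-replicate-zero n)
  sum-∑-≼         g (x ∷ xs) g≼B =
    ≼-trans (≼-reflexive (∑-distrib-+ (g x) (λ i → ∑ (map (λ x → g x i) xs))))
            (⊕-mono-≼ (g≼B x) (sum-∑-≼ g xs g≼B))

  -- Cuts a matrix into row `v`, column `v` without its diagonal entry, and the remaining minor. By
  -- symmetry and the zero diagonal the column again sums to row `v`.
  sum-sum-isolate : (F : Fin (suc n) → Fin (suc n) → R) (v : Fin (suc n)) →
    (∀ x y → F x y ≃ F y x) → F v v ≃ 0# →
    sum (λ x → sum (F x)) ≃
    ((sum (F v) ⊕ sum (F v)) ⊕ sum (λ x → sum (λ y → F (punchIn v x) (punchIn v y))))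
  sum-sum-isolate F v F-sym Fvv≈0 = begin-equality
    sum (λ x → sum (F x))
      ≈⟨ sum-remove {i = v} (λ x → sum (F x)) ⟩
    sum (F v) ⊕ sum (λ x → sum (F (punchIn v x)))
      ≈⟨ ⊕-congˡ (sum-cong-≋ λ x → sum-remove {i = v} (F (punchIn v x))) ⟩
    sum (F v) ⊕ sum (λ x → F (punchIn v x) v ⊕ minor x)
      ≈⟨ ⊕-congˡ (∑-distrib-+ (λ x → F (punchIn v x) v) minor) ⟩
    sum (F v) ⊕ (sum (λ x → F (punchIn v x) v) ⊕ sum minor)
      ≈⟨ ⊕-congˡ (⊕-congʳ column) ⟩
    sum (F v) ⊕ (sum (F v) ⊕ sum minor)
      ≈⟨ ⊕-assoc (sum (F v)) (sum (F v)) (sum minor) ⟨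
    (sum (F v) ⊕ sum (F v)) ⊕ sum minor ∎
    where
    minor = λ x → sum (λ y → F (punchIn v x) (punchIn v y))
    column : sum (λ x → F (punchIn v x) v) ≃ sum (F v)
    column = begin-equality
      sum (λ x → F (punchIn v x) v)            ≈⟨ sum-cong-≋ (λ x → F-sym (punchIn v x) v) ⟩
      sum (λ x → F v (punchIn v x))            ≈⟨ ⊕-identityˡ _ ⟨
      -- The vanishing diagonal entry is put back to complete the row.
      0# ⊕ sum (λ x → F v (punchIn v x))       ≈⟨ ⊕-congʳ Fvv≈0 ⟨
      F v v ⊕ sum (λ x → F v (punchIn v x))    ≈⟨ sum-remove {i = v} (F v) ⟨
      sum (F v)                                ∎

  -- The potential of a colouring.

  module _ (G : Graph n) (W : Fin s → Fin s → R) (W-sym : ∀ i j → W i j ≃ W j i) where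
    open Graph G

    -- The colour at `v` is a separate argument, so that recolourings of `v` can be compared against
    -- a fixed `c`.
    interferenceAs : Colouring n s → Fin n → Fin s → R
    interferenceAs c v i = ∑ (map (λ u → W (c u) i) (neighbours v))

    potential : Colouring n s → R
    potential c = sum (λ v → interferenceAs c v (c v))

    potential-cong : ∀ {c d} → c ≗ d → potential c ≡ potential d
    potential-cong c≗d = sum-cong-≗ λ v →
      cong ∑ (map-cong (λ u → cong₂ W (c≗d u) (c≗d v)) (neighbours v))

    -- Extends the sum over neighbours to all vertices, which makes the potential the total of a
    -- symmetric matrix with zero diagonal.
    edgeWeight : Colouring n s → Fin n → Fin n → R
    edgeWeight c v u = if does (v ~? u) then W (c u) (c v) else 0#

    interference≃sum : ∀ c v → interferenceAs c v (c v) ≃ sum (edgeWeight c v)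
    interference≃sum c v = ∑-filter (v ~?_) (λ u → W (c u) (c v)) id

    edgeWeight-sym : ∀ c u v → edgeWeight c u v ≃ edgeWeight c v u
    edgeWeight-sym c u v with u ~? v | v ~? u
    ... | yes _   | yes _   = W-sym (c v) (c u)
    ... | yes u~v | no v≁u  = contradiction (~-sym u~v) v≁u
    ... | no u≁v  | yes v~u = contradiction (~-sym v~u) u≁v
    ... | no _    | no _    = Eq.refl

    edgeWeight-irrefl : ∀ c v → edgeWeight c v v ≃ 0#
    edgeWeight-irrefl c v with v ~? v
    ... | yes v~v = contradiction v~v (~-irrefl refl)
    ... | no _    = Eq.refl

    recolour : Colouring n s → Fin n → Fin s → Colouring n s
    recolour c v i = updateAt c v (const i)

    -- A neighbour of `v` differs from `v` by irreflexivity, so it keeps its colour.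
    edgeWeight-recolour : ∀ c v i u →
      edgeWeight (recolour c v i) v u ≡ (if does (v ~? u) then W (c u) i else 0#)
    edgeWeight-recolour c v i u with v ~? u
    ... | yes v~u = cong₂ W (updateAt-minimal u v c (λ u≡v → ~-irrefl (≡.sym u≡v) v~u))
                            (updateAt-updates v c)
    ... | no _    = refl

    interference-recolour : ∀ c v i → sum (edgeWeight (recolour c v i) v) ≃ interferenceAs c v i
    interference-recolour c v i = begin-equality
      sum (edgeWeight (recolour c v i) v)
        ≡⟨ sum-cong-≗ (edgeWeight-recolour c v i) ⟩
      sum (λ u → if does (v ~? u) then W (c u) i else 0#)
        ≈⟨ ∑-filter (v ~?_) (λ u → W (c u) i) id ⟨
      interferenceAs c v i ∎

  -- Recolouring `v` leaves the minor away from `v` unchanged. Once it is cancelled, minimality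
  -- compares twice the row sum at `v` before and after.
  potential-minimal⇒≼ : (G : Graph n) (W : Fin s → Fin s → R) (W-sym : ∀ i j → W i j ≃ W j i) →
    (c : Colouring n s) → (∀ d → potential G W W-sym c ≼ potential G W W-sym d) →
    ∀ v i → interferenceAs G W W-sym c v (c v) ≼ interferenceAs G W W-sym c v i
  potential-minimal⇒≼ {n = suc n} {s = s} G W W-sym c minimal v i = begin
    interferenceAs G W W-sym c v (c v)   ≈⟨ interference≃sum G W W-sym c v ⟩
    sum (weight c v)                     ≤⟨ halve-≼ (⊕-cancelʳ-≼ (rest c) step) ⟩
    sum (weight c′ v)                    ≈⟨ interference-recolour G W W-sym c v i ⟩
    interferenceAs G W W-sym c v i       ∎
    where
    weight : Colouring (suc n) s → Fin (suc n) → Fin (suc n) → R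
    weight = edgeWeight G W W-sym
    c′ : Colouring (suc n) s
    c′ = recolour G W W-sym c v i
    rest : Colouring (suc n) s → R
    rest d = sum (λ x → sum (λ y → weight d (punchIn v x) (punchIn v y)))
    c′≡c : ∀ x → c′ (punchIn v x) ≡ c (punchIn v x)
    c′≡c x = updateAt-minimal (punchIn v x) v c (Fin.punchInᵢ≢i v x)
    rest≡ : rest c′ ≡ rest c
    rest≡ = sum-cong-≗ λ x → sum-cong-≗ λ y →
      cong₂ (λ a b → if does (Graph._~?_ G (punchIn v x) (punchIn v y)) then W a b else 0#)
        (c′≡c y) (c′≡c x)
    split : ∀ d → potential G W W-sym d ≃ ((sum (weight d v) ⊕ sum (weight d v)) ⊕ rest d)
    split d = begin-equality
      potential G W W-sym d
        ≈⟨ sum-cong-≋ (interference≃sum G W W-sym d) ⟩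
      sum (λ x → sum (weight d x))
        ≈⟨ sum-sum-isolate (weight d) v (edgeWeight-sym G W W-sym d) (edgeWeight-irrefl G W W-sym d v) ⟩
      (sum (weight d v) ⊕ sum (weight d v)) ⊕ rest d ∎
    step : ((sum (weight c v) ⊕ sum (weight c v)) ⊕ rest c) ≼
           ((sum (weight c′ v) ⊕ sum (weight c′ v)) ⊕ rest c)
    step = begin
      (sum (weight c v) ⊕ sum (weight c v)) ⊕ rest c       ≈⟨ split c ⟨
      potential G W W-sym c                                ≤⟨ minimal c′ ⟩
      potential G W W-sym c′                               ≈⟨ split c′ ⟩
      (sum (weight c′ v) ⊕ sum (weight c′ v)) ⊕ rest c′    ≡⟨ cong₂ _⊕_ refl rest≡ ⟩
      (sum (weight c′ v) ⊕ sum (weight c′ v)) ⊕ rest c     ∎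

  -- The division by `k` is expressed by repeated sums, as the abstract carrier has no scalars.
  ¬¬∃-balanced : .{{_ : NonZero k}} (k≤s : k ℕ.≤ s) (G : Graph n) (W : Fin s → Fin s → R) →
    (∀ i j → W i j ≃ W j i) → (∀ i j → 0# ≼ W i j) →
    ¬ ¬ (Σ[ c ∈ Colouring n k ] ∀ v → let c′ = λ u → inject≤ {k} (c u) k≤s in
      ∑ (replicate k (∑ (map (λ u → W (c′ u) (c′ v)) (Graph.neighbours G v)))) ≼
      ∑ (replicate (Δ G) (max (tabulate λ i → ∑ (tabulate (W i))))))
  ¬¬∃-balanced {k@(suc _)} {s} {n} k≤s G W W-sym 0≼W =
    -- Colourings here take values in `Fin k`, so the bound on the number of colours is built in and
    -- the predicate is trivial.
    let (m , lower , attained) = ∃-minimum-colouring {P = λ _ → ⊤} (λ _ → yes tt) _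
          (potential G W′ W′-sym) (potential-cong G W′ W′-sym) (λ _ → zero) tt
    in ¬¬-map (λ (c , _ , Φc≼m) → c , balanced c (λ d → ≼-trans Φc≼m (lower d tt))) attained
    where
    open Graph G
    ι : Fin k → Fin s
    ι i = inject≤ i k≤s
    W′ : Fin k → Fin k → R
    W′ i j = W (ι i) (ι j)
    W′-sym : ∀ i j → W′ i j ≃ W′ j i
    W′-sym i j = W-sym (ι i) (ι j)
    rowSums : List R
    rowSums = tabulate λ i → ∑ (tabulate (W i))
    ‖W‖ : R
    ‖W‖ = max rowSums
    row≼‖W‖ : ∀ i → sum (W′ i) ≼ ‖W‖
    row≼‖W‖ i = begin
      sum (W′ i)                ≤⟨ sum-inject≤-≼ k≤s (0≼W (ι i)) ⟩
      sum (W (ι i))             ≡⟨ ∑-tabulate (W (ι i)) ⟨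
      ∑ (tabulate (W (ι i)))    ≤⟨ x∈xs⇒x≼max {xs = rowSums} (∈-tabulate⁺ (ι i)) ⟩
      ‖W‖                       ∎
    balanced : ∀ c → (∀ d → potential G W′ W′-sym c ≼ potential G W′ W′-sym d) → ∀ v →
      ∑ (replicate k (interferenceAs G W′ W′-sym c v (c v))) ≼ ∑ (replicate (Δ G) ‖W‖)
    balanced c minimal v = begin
      ∑ (replicate k (interferenceAs G W′ W′-sym c v (c v)))
        ≡⟨ sum-const k (interferenceAs G W′ W′-sym c v (c v)) ⟨
      sum {k} (λ _ → interferenceAs G W′ W′-sym c v (c v))
        -- The `i`-th copy is compared with the interference that `v` would receive in colour `i`.
        ≤⟨ sum-mono-≼ (potential-minimal⇒≼ G W′ W′-sym c minimal v) ⟩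
      sum (interferenceAs G W′ W′-sym c v)
        ≤⟨ sum-∑-≼ (λ u → W′ (c u)) (neighbours v) (λ u → row≼‖W‖ (c u)) ⟩
      ∑ (replicate (degree v) ‖W‖)
        ≤⟨ ∑-replicate-monoˡ (0≼max rowSums) (degree≤Δ G v) ⟩
      ∑ (replicate (Δ G) ‖W‖) ∎

-- Instantiation at the reals.

⊔-lub : ∀ {x y} z → x ⊑ z → y ⊑ z → x ⊔ y ⊑ z
⊔-lub {x} {y} z ⟨ x≤z ⟩ ⟨ y≤z ⟩ = ⟨ bound ⟩
  where
  bound : x ⊔ y ≤ z
  bound ε ε>0 =
    let (M , hx) = x≤z ε ε>0
        (N , hy) = y≤z ε ε>0
    in M ℕ.⊔ N , λ n ≤n →
      ℚ.⊔-lub {_} {seq x n} {seq y n} (hx n (ℕ.m⊔n≤o⇒m≤o M N ≤n)) (hy n (ℕ.m⊔n≤o⇒n≤o M N ≤n))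

⊑-isOrderedMonoid : IsOrderedMonoid _≋_ _⊑_ _+_ _⊔_ _⊓_ 0ℝ
⊑-isOrderedMonoid = record
  { isCommutativeMonoid = CommutativeMonoid.isCommutativeMonoid +-commutativeMonoid
  ; isPartialOrder      = Poset.isPartialOrder ⊑-poset
  ; ⊕-mono-≼            = +-mono-⊑
  ; ⊕-cancelʳ-≼         = +-cancelʳ-⊑
  ; halve-≼             = x+x⊑y+y⇒x⊑y
  ; supremum            = λ x y →
      pointwise-≤ {x} {x ⊔ y} (λ n → ℚ.p≤p⊔q (seq x n) (seq y n)) ,
      pointwise-≤ {y} {x ⊔ y} (λ n → ℚ.p≤q⊔p (seq x n) (seq y n)) ,
      ⊔-lub {x} {y}
  ; infimum             = λ x y → x⊓y⊑x x y , x⊓y⊑y x y , λ z → ⊓-glb {x} {y} {z}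
  ; ⋠⇒≽                 = ⋢⇒⊒
  }

open OrderedMonoid ⊑-isOrderedMonoid

interference-cong : (G : Graph n) (S : Spectrum s) {c d : Colouring n s} → c ≗ d →
                    interference G S c ≗ interference G S d
interference-cong G S c≗d v = cong sumℝ (map-cong (λ u → cong₂ W (c≗d u) (c≗d v)) (neighbours v))
  where open Graph G; open Spectrum S

-- Existence and upper bound of the minimum threshold.

¬¬Admits-bound : (G : Graph n) (S : Spectrum s) (k : ℕ) .{{_ : NonZero k}} → k ℕ.≤ s →
                 ¬ ¬ Admits G S k ((+ Δ G / k) · ‖ S ‖∞)
¬¬Admits-bound {n} {s} G S k {{k≢0}} k≤s = ¬¬-map admits
  (¬¬∃-balanced {{k≢0}} k≤s G W (λ i j → let (p , q) = W-sym i j in ⟨ p ⟩ , ⟨ q ⟩) (λ i j → ⟨ W-nonneg i j ⟩))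
  where
  open Spectrum S
  embed : Colouring n k → Colouring n s
  embed c v = inject≤ (c v) k≤s
  admits : (Σ[ c ∈ Colouring n k ] ∀ v →
             sumℝ (replicate k (interference G S (embed c) v)) ⊑ sumℝ (replicate (Δ G) ‖ S ‖∞)) →
           Admits G S k (((+ Δ G / k) {{k≢0}}) · ‖ S ‖∞)
  admits (c , balanced) = embed c , ∘-isColouringWith (λ i → inject≤ i k≤s) c ,
    λ v → ⊑⇒≤ (replicate-⊑⇒⊑/ k (Δ G) {{k≢0}} {interference G S (embed c) v} {‖ S ‖∞} (balanced v))

0ℝ⊑bound : (G : Graph n) (S : Spectrum s) (k : ℕ) .{{_ : NonZero k}} → 0ℝ ⊑ (+ Δ G / k) · ‖ S ‖∞
0ℝ⊑bound {s = s} G S k {{k≢0}} = pointwise-≤ {0ℝ} {((+ Δ G / k) {{k≢0}}) · ‖ S ‖∞} λ n →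
  ≡.subst (ℚ._≤ ((+ Δ G / k) {{k≢0}}) ℚ.* seq ‖ S ‖∞ n) (ℚ.*-zeroʳ ((+ Δ G / k) {{k≢0}}))
    (ℚ.*-monoˡ-≤-nonNeg ((+ Δ G / k) {{k≢0}}) {{ℚ.normalize-nonNeg (Δ G) k {{k≢0}}}}
      (0≤maxℝ (tabulate λ i → sumℝ (tabulate (Spectrum.W S i))) n))
  where
  0≤maxℝ : ∀ xs n → 0ℚ ℚ.≤ seq (maxℝ xs) n
  0≤maxℝ []       n = ℚ.≤-refl
  0≤maxℝ (x ∷ xs) n = ℚ.≤-trans (0≤maxℝ xs n) (ℚ.p≤q⊔p (seq x n) (seq (maxℝ xs) n))

-- The threshold is the minimum, over all `k`-colourings, of the largest interference at a vertex.
-- The value is constructed outright; only its attainment is double-negated.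
∃-minThreshold : (G : Graph n) (S : Spectrum s) (k : ℕ) .{{_ : NonZero k}} → k ℕ.≤ s →
                 ∃[ T ] IsMinThreshold G S k T
∃-minThreshold {n} {s} G S k@(suc _) k≤s =
  let (T , lower , attained) = ∃-minimum-colouring {P = IsColouringWith k}
        (λ c → ∣ coloursUsed c ∣ ℕ.≤? k)
        (λ c≗d → ≡.subst (λ p → ∣ p ∣ ℕ.≤ k) (coloursUsed-cong c≗d))
        worst (λ c≗d → cong maxℝ (tabulate-cong (interference-cong G S c≗d)))
        (λ _ → inject≤ zero k≤s) (∘-isColouringWith {k} {s} {n} (λ i → inject≤ i k≤s) (λ _ → zero))
  in T
   , ⊑⇒≤ (⊑-stable {0ℝ} {T} (¬¬-map
       (λ (c , _ , worst⊑T) → ⊑-trans {0ℝ} {worst c} {T} (0≼max (interferences c)) worst⊑T) attained))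
   , ¬¬-map (λ (c , c-k , worst⊑T) → c , c-k , λ v →
       ⊑⇒≤ (⊑-trans {interference G S c v} {worst c} {T}
              (x∈xs⇒x≼max {xs = interferences c} (∈-tabulate⁺ v)) worst⊑T)) attained
   , λ t 0≤t (c , c-k , I≤t) → ⊑⇒≤ (⊑-trans {T} {worst c} {t} (lower c c-k)
       -- `maxℝ` starts from `0ℝ`, hence the use of `0≤t`.
       (max-lub {t} {interferences c} ⟨ 0≤t ⟩ (All.tabulate⁺ λ v → ⟨ I≤t v ⟩)))
  where
  interferences : Colouring n s → List ℝ
  interferences c = tabulate (interference G S c)
  worst : Colouring n s → ℝ
  worst c = maxℝ (interferences c)

-- Minimality of `T` asks for an actual colouring, while one is known only up to double negation;
-- `⊑-stable` removes the double negation from the conclusion.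
minThreshold≤bound : (G : Graph n) (S : Spectrum s) (k : ℕ) .{{_ : NonZero k}} → k ℕ.≤ s →
                     ∀ T → IsMinThreshold G S k T → T ≤ (+ Δ G / k) · ‖ S ‖∞
minThreshold≤bound G S k {{k≢0}} k≤s T (_ , _ , minimal) = ⊑⇒≤ (⊑-stable {T} {bound}
  (¬¬-map (λ admits → ⟨ minimal bound (⊑⇒≤ (0ℝ⊑bound G S k {{k≢0}})) admits ⟩)
          (¬¬Admits-bound G S k {{k≢0}} k≤s)))
  where
  bound : ℝ
  bound = ((+ Δ G / k) {{k≢0}}) · ‖ S ‖∞

-- Tightness on a single edge.

K₂ : Graph 2
K₂ = record
  { _~_      = _≢_
  ; _~?_     = λ x y → ¬? (x Fin.≟ y)
  ; ~-sym    = ≡.≢-sym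
  ; ~-irrefl = λ x≡y x≢y → x≢y x≡y
  }

1ℝ : ℝ
1ℝ = mkℝ (λ _ → 1ℚ) λ _ ε>0 → 0 , λ _ _ _ _ → ℚ.<⇒≤ ε>0

allOnes : ∀ s → Spectrum s
allOnes s = record
  { W        = λ _ _ → 1ℝ
  ; W-sym    = λ _ _ → ⊑⇒≤ (⊑-refl {1ℝ}) , ⊑⇒≤ (⊑-refl {1ℝ})
  ; W-nonneg = λ _ _ → ⊑⇒≤ (pointwise-≤ {0ℝ} {1ℝ} λ _ → ℚ.nonNegative⁻¹ 1ℚ)
  }

-- Once `v` is a concrete vertex, its list of neighbours computes to a single element.
K₂-interference : ∀ c v n → seq (interference K₂ (allOnes 2) c v) n ≡ 1ℚ
K₂-interference c zero       n = refl
K₂-interference c (suc zero) n = refl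

K₂-minThreshold : IsMinThreshold K₂ (allOnes 2) 2 1ℝ
K₂-minThreshold =
    ⊑⇒≤ (pointwise-≤ {0ℝ} {1ℝ} λ _ → ℚ.nonNegative⁻¹ 1ℚ)
  , contradiction (id , ∘-isColouringWith id id , λ v → ⊑⇒≤ (proj₁ (I≋1 id v)))
  -- Every colouring gives interference 1 at vertex `zero`, so `t` is at least 1.
  , λ t _ (c , _ , I≤t) → ⊑⇒≤ (⊑-trans {1ℝ} {I c zero} {t} (proj₂ (I≋1 c zero)) ⟨ I≤t zero ⟩)
  where
  I : Colouring 2 2 → Fin 2 → ℝ
  I = interference K₂ (allOnes 2)
  I≋1 : ∀ c v → I c v ≋ 1ℝ
  I≋1 c v = pointwise-≡ {I c v} {1ℝ} (K₂-interference c v)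

K₂-tight : 1ℝ ≋ (+ Δ K₂ / 2) · ‖ allOnes 2 ‖∞
-- Here `Δ K₂` is 1 and both row sums are 2, so the bound computes to 1/2 times 2.
K₂-tight = pointwise-≡ {1ℝ} {(+ Δ K₂ / 2) · ‖ allOnes 2 ‖∞} λ _ → refl

theorem3 : (∀ {n s} (G : Graph n) (S : Spectrum s) (k : ℕ) .{{_ : NonZero k}} → 2 ℕ.≤ k → k ℕ.≤ s →
    (∃[ T ] IsMinThreshold G S k T) ×
    (∀ T → IsMinThreshold G S k T → T ≤ (+ Δ G / k) · ‖ S ‖∞))
    ×
    (∃[ n ] ∃[ s ] Σ[ G ∈ Graph n ] Σ[ S ∈ Spectrum s ] Σ[ k ∈ ℕ ] Σ[ k≢0 ∈ NonZero k ] ∃[ T ]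
    (2 ℕ.≤ k × k ℕ.≤ s × IsMinThreshold G S k T × T ≈ ((+ Δ G / k) {{k≢0}}) · ‖ S ‖∞))
theorem3 =
    (λ G S k {{k≢0}} _ k≤s → ∃-minThreshold G S k {{k≢0}} k≤s , minThreshold≤bound G S k {{k≢0}} k≤s)
  , 2 , 2 , K₂ , allOnes 2 , 2 , _ , 1ℝ , ℕ.≤-refl , ℕ.≤-refl , K₂-minThreshold ,
    ⊑⇒≤ (proj₁ K₂-tight) , ⊑⇒≤ (proj₂ K₂-tight)
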